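{- For every claw-free cubic graph $G$, $\nu_2(G) \geq \frac{5}{6}\cdot |V(G)|$.
   Context: Graphs are finite, without loops, possibly with multiple edges; a graph is cubic if every vertex has degree $3$, and claw-free if it has no induced subgraph isomorphic to $K_{1,3}$. For $k\geq 1$, $\nu_k(G)$ is the maximum number of edges of a $k$-edge-colorable subgraph of $G$. -}

module Defs where

open import Data.Empty using (⊥-elim)
open import Data.Fin using (Fin; zero; suc; finToFun; funToFin)
open import Data.Fin.Properties using (any?; all?; finToFun-funToFin) renaming (_≟_ to _≟ᶠ_)
open import Data.Fin.Subset using (Subset; _∈_; ∣_∣; ⊤; ⊥)
open import Data.Fin.Subset.Properties using (anySubset?; _∈?_; ∈⊤; ∉⊥; ∣⊥∣≡0; ∣p∣≤n)
open import Data.Nat using (ℕ; zero; suc; _≤_; _≟_; s≤s⁻¹; NonZero)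
open import Data.Nat.Properties using (≤∧≢⇒<)
open import Data.Product using (Σ; ∃; ∃-syntax; _×_; _,_; proj₁; proj₂)
open import Data.Sum using (_⊎_; inj₁; inj₂)
open import Data.Vec using (tabulate)
open import Function.Definitions using (Injective)
open import Level using (0ℓ)
open import Relation.Binary.PropositionalEquality using (_≡_; _≢_; refl; sym; subst₂)
open import Relation.Nullary using (¬_; Dec; yes; no; does)
open import Relation.Nullary.Decidable using (_×-dec_; _⊎-dec_; _→-dec_; ¬?; map′)
open import Relation.Unary using (Pred; Decidable)

-- Loopless multigraphs: distinct edges may have the same ends, and the order
-- in which the two ends of an edge are listed carries no meaning.
record Graph : Set where
  field
    ∣V∣ ∣E∣  : ℕ
    ends     : Fin ∣E∣ → Fin ∣V∣ × Fin ∣V∣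
    loopless : ∀ e → proj₁ (ends e) ≢ proj₂ (ends e)

  Vertex Edge : Set
  Vertex = Fin ∣V∣
  Edge   = Fin ∣E∣

  Joins : Edge → Vertex → Vertex → Set
  Joins e u v = ends e ≡ (u , v) ⊎ ends e ≡ (v , u)

  Incident : Vertex → Edge → Set
  Incident v e = proj₁ (ends e) ≡ v ⊎ proj₂ (ends e) ≡ v

  incident? : ∀ v e → Dec (Incident v e)
  incident? v e = (proj₁ (ends e) ≟ᶠ v) ⊎-dec (proj₂ (ends e) ≟ᶠ v)

  degree : Vertex → ℕ
  degree v = ∣ tabulate (λ e → does (incident? v e)) ∣

  ShareEnd : Edge → Edge → Set
  ShareEnd e f = ∃[ v ] (Incident v e × Incident v f)

open Graph

Cubic : Graph → Set
Cubic G = ∀ v → degree G v ≡ 3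

-- An isomorphism of H onto the subgraph of G induced by the image of onV.
record InducedCopy (H G : Graph) : Set where
  field
    onV           : Vertex H → Vertex G
    onE           : Edge H → Edge G
    onV-injective : Injective _≡_ _≡_ onV
    onE-injective : Injective _≡_ _≡_ onE
    preserves     : ∀ {e u v} → Joins H e u v → Joins G (onE e) (onV u) (onV v)
    induced       : ∀ {f u v} → Joins G f (onV u) (onV v) → ∃[ e ] onE e ≡ f

K₁,₃ : Graph
K₁,₃ = record
  { ∣V∣      = 4
  ; ∣E∣      = 3
  ; ends     = λ i → zero , suc i
  ; loopless = λ _ ()
  }

ClawFree : Graph → Set
ClawFree G = ¬ InducedCopy K₁,₃ G

record Subgraph (G : Graph) : Set where
  field
    vertices : Subset (∣V∣ G)
    edges    : Subset (∣E∣ G)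
    closed   : ∀ {e v} → e ∈ edges → Incident G v e → v ∈ vertices

open Subgraph

-- The colouring is a function on all edges of the ambient graph, but its
-- values outside S are unconstrained.
ProperOn : (G : Graph) {k : ℕ} → Subset (∣E∣ G) → (Edge G → Fin k) → Set
ProperOn G S c = ∀ e f → e ∈ S → f ∈ S → e ≢ f → ShareEnd G e f → c e ≢ c f

EdgeColourable : {G : Graph} (k : ℕ) .{{_ : NonZero k}} → Subgraph G → Set
EdgeColourable {G} k H = ∃[ c ] ProperOn G {k} (edges H) c

IsMaximum : Pred ℕ 0ℓ → ℕ → Set
IsMaximum P m = P m × (∀ j → P j → j ≤ m)

ColourableSize : (k : ℕ) .{{_ : NonZero k}} → Graph → ℕ → Set
ColourableSize k G m = Σ (Subgraph G) λ H → EdgeColourable k H × ∣ edges H ∣ ≡ m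

private
  maximum : {P : Pred ℕ 0ℓ} → Decidable P → P 0 →
            ∀ b → (∀ j → P j → j ≤ b) → ∃ (IsMaximum P)
  maximum P? p₀ zero    bound = 0 , p₀ , bound
  maximum P? p₀ (suc b) bound with P? (suc b)
  ... | yes p = suc b , p , bound
  ... | no ¬p = maximum P? p₀ b λ j pj →
    s≤s⁻¹ (≤∧≢⇒< (bound j pj) λ { refl → ¬p pj })

  shareEnd? : ∀ G e f → Dec (ShareEnd G e f)
  shareEnd? G e f = any? λ v → incident? G v e ×-dec incident? G v f

  properOn? : ∀ G {k} S (c : Edge G → Fin k) → Dec (ProperOn G S c)
  properOn? G S c = all? λ e → all? λ f →
    (e ∈? S) →-dec ((f ∈? S) →-dec (¬? (e ≟ᶠ f) →-dec
      (shareEnd? G e f →-dec ¬? (c e ≟ᶠ c f))))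

  colouring? : ∀ G k S → Dec (∃[ c ] ProperOn G {k} S c)
  colouring? G k S = map′
    (λ (i , p) → finToFun i , p)
    (λ (c , p) → funToFin c , λ e f e∈ f∈ e≢f s →
      subst₂ _≢_ (sym (finToFun-funToFin c e)) (sym (finToFun-funToFin c f))
        (p e f e∈ f∈ e≢f s))
    (any? λ i → properOn? G S (finToFun i))

  colourableSize? : ∀ k .{{_ : NonZero k}} G → Decidable (ColourableSize k G)
  colourableSize? k G m = map′
    (λ (S , col , eq) →
      record { vertices = ⊤ ; edges = S ; closed = λ _ _ → ∈⊤ } , col , eq)
    (λ (H , col , eq) → edges H , col , eq)
    (anySubset? λ S → colouring? G k S ×-dec (∣ S ∣ ≟ m))

  emptyColourable : ∀ k .{{_ : NonZero k}} G → ColourableSize k G 0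
  emptyColourable (suc k) G =
    record { vertices = ⊥ ; edges = ⊥ ; closed = λ e∈⊥ → ⊥-elim (∉⊥ e∈⊥) } ,
    ((λ _ → zero) , λ _ _ e∈⊥ → ⊥-elim (∉⊥ e∈⊥)) ,
    ∣⊥∣≡0 (∣E∣ G)

ν-exists : ∀ k .{{_ : NonZero k}} G → ∃ (IsMaximum (ColourableSize k G))
ν-exists k G = maximum (colourableSize? k G) (emptyColourable k G) (∣E∣ G)
  λ { _ (H , _ , refl) → ∣p∣≤n (edges H) }

ν : (k : ℕ) .{{_ : NonZero k}} → Graph → ℕ
ν k G = proj₁ (ν-exists k G)

ν-isMaximum : ∀ k .{{_ : NonZero k}} G → IsMaximum (ColourableSize k G) (ν k G)
ν-isMaximum k G = proj₂ (ν-exists k G)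

{-# OPTIONS --safe #-}

-- A claw-free cubic graph has a perfect matching: the edges that lie in no
-- triangle and are parallel to no other edge form a matching, and every maximal
-- matching containing them is perfect.  Let M be a perfect matching and N a
-- matching that is maximal among the edges outside M.  Of the n edges outside M,
-- each one not in N has an end covered by N, and each vertex covered by N is on
-- only one such edge; hence n − |N| ≤ 2|N|.  So |M| + |N| ≥ n/2 + n/3, and the
-- two matchings are the two colour classes.
module Submission where

open import Defs
open import Data.Bool using (true; false; if_then_else_)
open import Data.Empty using (⊥; ⊥-elim)
open import Data.Fin using (Fin; zero; suc)
open import Data.Fin.Properties using (any?) renaming (_≟_ to _≟ᶠ_)
open import Data.Fin.Subset
  using (Subset; inside; outside; _∈_; _∉_; _⊆_; _-_; _∪_; ∁; ⁅_⁆; ∣_∣; Nonempty)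
  renaming (⊥ to ∅; ⊤ to full)
open import Data.Fin.Subset.Properties
import Data.Integer as ℤ
import Data.Integer.Properties as ℤ
open import Data.List using (List; []; _∷_; allFin)
open import Data.List.Membership.Propositional using () renaming (_∈_ to _∈ˡ_)
open import Data.List.Membership.Propositional.Properties using (∈-allFin)
open import Data.List.Relation.Unary.Any using (here; there)
import Data.Nat as Nat
open import Data.Nat using (ℕ; zero; suc; _+_; _≤_; z≤n; s≤s)
open import Data.Nat.Properties hiding (_≟_)
open import Data.Nat.Solver using (module +-*-Solver)
open import Data.Product using (∃-syntax; _×_; _,_; proj₁; proj₂)
open import Data.Product.Properties using (≡-dec)
open import Data.Rational using (toℚᵘ)
open import Data.Rational.Properties using (toℚᵘ-cancel-≤; toℚᵘ-fromℚᵘ; toℚᵘ-homo-*)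
import Data.Rational.Unnormalised as ℚᵘ
open import Data.Rational.Unnormalised using (mkℚᵘ)
import Data.Rational.Unnormalised.Properties as ℚᵘ
open import Data.Sum using (_⊎_; inj₁; inj₂; [_,_]′; swap)
open import Data.Vec using ([]; _∷_; tabulate; here; there)
open import Data.Vec.Properties using (lookup∘tabulate; []=⇒lookup; lookup⇒[]=)
open import Function using (_∘_; id)
open import Relation.Binary.PropositionalEquality
open import Relation.Nullary using (¬_; Dec; yes; no; does; contradiction)
open import Relation.Nullary.Decidable
  using (_×-dec_; _⊎-dec_; ¬?; dec-true; dec-false; decidable-stable)
open import Algebra.Properties.Semiring.Sum +-*-semiring
  using (sum; sum-cong-≗; sum-replicate-zero; ∑-comm; ∑-distrib-+; *-distribˡ-sum)

-- Removing elements from finite subsets, and subsets selected by decidable predicates.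

module _ {n : ℕ} where

  -- Removing a member strictly lowers the size, whereas removing `y` a second time changes nothing.
  y∉p-y : (p : Subset n) (y : Fin n) → y ∉ p - y
  y∉p-y p y y∈ = <-irrefl (cong ∣_∣ (p─q─q≡p─q p ⁅ y ⁆)) (x∈p⇒∣p-x∣<∣p∣ y∈)

  x∈p-y⇒x≢y : ∀ {p : Subset n} {x y} → x ∈ p - y → x ≢ y
  x∈p-y⇒x≢y {p} x∈ refl = y∉p-y p _ x∈

  nonempty-of-size : ∀ {p : Subset n} {k} → ∣ p ∣ ≡ suc k → Nonempty p
  nonempty-of-size {p} eq with nonempty? p
  ... | yes ne = ne
  ... | no ¬ne rewrite Empty-unique {p = p} ¬ne | ∣⊥∣≡0 n = contradiction eq λ ()

∣p∣≡1+∣p-x∣ : ∀ {n} {p : Subset n} {x} → x ∈ p → ∣ p ∣ ≡ suc ∣ p - x ∣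
∣p∣≡1+∣p-x∣ {p = _ ∷ p}       here       = cong (suc ∘ ∣_∣) (sym (p─⊥≡p p))
∣p∣≡1+∣p-x∣ {p = inside ∷ _}  (there x∈) = cong suc (∣p∣≡1+∣p-x∣ x∈)
∣p∣≡1+∣p-x∣ {p = outside ∷ _} (there x∈) = ∣p∣≡1+∣p-x∣ x∈

module _ {n} {P : Fin n → Set} (P? : ∀ i → Dec (P i)) where

  ∈-select : ∀ {i} → P i → i ∈ tabulate (does ∘ P?)
  ∈-select {i} Pi = lookup⇒[]= i _ (trans (lookup∘tabulate _ i) (dec-true (P? i) Pi))

  ∈-select⁻ : ∀ {i} → i ∈ tabulate (does ∘ P?) → P i
  ∈-select⁻ {i} i∈ with P? i | trans (sym (lookup∘tabulate (does ∘ P?) i)) ([]=⇒lookup i∈)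
  ... | yes Pi | _ = Pi

-- Matchings and their greedy extension.

module Matchings (G : Graph) where
  open Graph G

  Conflict : Edge → Edge → Set
  Conflict e f = e ≢ f × ShareEnd e f

  conflict? : ∀ e f → Dec (Conflict e f)
  conflict? e f = ¬? (e ≟ᶠ f) ×-dec any? λ v → incident? v e ×-dec incident? v f

  conflict-sym : ∀ {e f} → Conflict e f → Conflict f e
  conflict-sym (e≢f , v , i , j) = e≢f ∘ sym , v , j , i

  Matching : Subset ∣E∣ → Set
  Matching M = ∀ {e f} → e ∈ M → f ∈ M → ¬ Conflict e f

  add-edge : ∀ {M e} → Matching M → (∀ {f} → f ∈ M → ¬ Conflict e f) → Matching (M ∪ ⁅ e ⁆)
  add-edge {M} {e} M-matching free {f} {g} f∈ g∈ f#g with x∈p∪q⁻ M ⁅ e ⁆ f∈ | x∈p∪q⁻ M ⁅ e ⁆ g∈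
  ... | inj₁ f∈M | inj₁ g∈M = M-matching f∈M g∈M f#g
  ... | inj₁ f∈M | inj₂ g∈e rewrite x∈⁅y⁆⇒x≡y e g∈e = free f∈M (conflict-sym f#g)
  ... | inj₂ f∈e | inj₁ g∈M rewrite x∈⁅y⁆⇒x≡y e f∈e = free g∈M f#g
  ... | inj₂ f∈e | inj₂ g∈e = proj₁ f#g (trans (x∈⁅y⁆⇒x≡y e f∈e) (sym (x∈⁅y⁆⇒x≡y e g∈e)))

  -- A greedy pass over `es`: an edge of `A` is added unless it conflicts with an edge already
  -- present. The matching only grows, so the edge that blocks a rejected one is still there at the
  -- end.
  extend-along : (A : Subset ∣E∣) (es : List Edge) (M : Subset ∣E∣) → Matching M →
                 ∃[ N ] M ⊆ N × Matching N × (∀ {e} → e ∈ N → e ∈ M ⊎ e ∈ A) ×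
                        (∀ {e} → e ∈ˡ es → e ∈ A → e ∉ N → ∃[ f ] f ∈ N × Conflict e f)
  extend-along A [] M M-matching = M , id , M-matching , inj₁ , λ ()
  extend-along A (e ∷ es) M M-matching
    with e ∈? A | any? (λ f → (f ∈? M) ×-dec conflict? e f)
  ... | no e∉A | _ =
    let N , M⊆N , N-matching , N⊆ , maximal = extend-along A es M M-matching in
    N , M⊆N , N-matching , N⊆ , λ
      { (here refl) e∈A _ → contradiction e∈A e∉A
      ; (there f∈)        → maximal f∈ }
  ... | yes _ | yes (f , f∈M , e#f) =
    let N , M⊆N , N-matching , N⊆ , maximal = extend-along A es M M-matching in
    N , M⊆N , N-matching , N⊆ , λ
      { (here refl) _ _ → f , M⊆N f∈M , e#f
      ; (there f∈)      → maximal f∈ }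
  ... | yes e∈A | no free =
    let N , M⁺⊆N , N-matching , N⊆ , maximal =
          extend-along A es (M ∪ ⁅ e ⁆) (add-edge M-matching λ f∈M e#f → free (_ , f∈M , e#f)) in
    N , M⁺⊆N ∘ p⊆p∪q ⁅ e ⁆ , N-matching , [ split , inj₂ ]′ ∘ N⊆ , λ
      { (here refl) _ e∉N → contradiction (M⁺⊆N (q⊆p∪q M ⁅ e ⁆ (x∈⁅x⁆ e))) e∉N
      ; (there f∈)        → maximal f∈ }
    where
    split : ∀ {f} → f ∈ M ∪ ⁅ e ⁆ → f ∈ M ⊎ f ∈ A
    split f∈ with x∈p∪q⁻ M ⁅ e ⁆ f∈
    ... | inj₁ f∈M = inj₁ f∈M
    ... | inj₂ f∈e rewrite x∈⁅y⁆⇒x≡y e f∈e = inj₂ e∈A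

  maximal-matching : (A M : Subset ∣E∣) → Matching M →
    ∃[ N ] M ⊆ N × Matching N × (∀ {e} → e ∈ N → e ∈ M ⊎ e ∈ A) ×
           (∀ {e} → e ∈ A → e ∉ N → ∃[ f ] f ∈ N × Conflict e f)
  maximal-matching A M M-matching =
    let N , M⊆N , N-matching , N⊆ , maximal = extend-along A (allFin _) M M-matching in
    N , M⊆N , N-matching , N⊆ , maximal (∈-allFin _)

-- Edges and their ends; the three edges at a vertex of a cubic graph.

module CubicGraph (G : Graph) (cubic : Cubic G) where
  open Graph G
  open Matchings G

  joins-sym : ∀ {e u v} → Joins e u v → Joins e v u
  joins-sym = swap

  joins-≢ : ∀ {e u v} → Joins e u v → u ≢ v
  joins-≢ {e} (inj₁ p) refl = loopless e (trans (cong proj₁ p) (cong proj₂ (sym p)))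
  joins-≢ {e} (inj₂ p) refl = loopless e (trans (cong proj₁ p) (cong proj₂ (sym p)))

  joins-end : ∀ {e u v w} → Joins e u v → Joins e u w → v ≡ w
  joins-end (inj₁ p) (inj₁ q) = cong proj₂ (trans (sym p) q)
  joins-end (inj₂ p) (inj₂ q) = cong proj₁ (trans (sym p) q)
  joins-end {e} (inj₁ p) (inj₂ q) = ⊥-elim (loopless e (trans (cong proj₁ p) (cong proj₂ (sym q))))
  joins-end {e} (inj₂ p) (inj₁ q) = ⊥-elim (loopless e (trans (cong proj₁ q) (cong proj₂ (sym p))))

  joins? : ∀ e u v → Dec (Joins e u v)
  joins? e u v = ≡-dec _≟ᶠ_ _≟ᶠ_ _ _ ⊎-dec ≡-dec _≟ᶠ_ _≟ᶠ_ _ _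

  incidentˡ : ∀ {e u v} → Joins e u v → Incident u e
  incidentˡ (inj₁ p) = inj₁ (cong proj₁ p)
  incidentˡ (inj₂ p) = inj₂ (cong proj₂ p)

  other-end : ∀ {e v} → Incident v e → ∃[ w ] Joins e v w
  other-end (inj₁ refl) = _ , inj₁ refl
  other-end (inj₂ refl) = _ , inj₂ refl

  incident-ends : ∀ {e u v w} → Joins e u v → Incident w e → w ≡ u ⊎ w ≡ v
  incident-ends (inj₁ refl) (inj₁ refl) = inj₁ refl
  incident-ends (inj₁ refl) (inj₂ refl) = inj₂ refl
  incident-ends (inj₂ refl) (inj₁ refl) = inj₂ refl
  incident-ends (inj₂ refl) (inj₂ refl) = inj₁ refl

  -- Only the edges are required to be distinct: parallel edges make some of `x`, `y`, `z` coincide.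
  record Star (v : Vertex) (a b c : Edge) (x y z : Vertex) : Set where
    constructor star
    field
      a≢b : a ≢ b
      a≢c : a ≢ c
      b≢c : b ≢ c
      a∶x : Joins a v x
      b∶y : Joins b v y
      c∶z : Joins c v z

  open Star

  private
    -- Spelled as in `degree`, so that `cubic v` applies directly to the size of this set.
    edges-at : ∀ v → Subset ∣E∣
    edges-at v = tabulate λ e → does (incident? v e)

    at : ∀ {e v w} → Joins e v w → e ∈ edges-at v
    at {v = v} j = ∈-select (incident? v) (incidentˡ j)

    at⁻ : ∀ {e v} → e ∈ edges-at v → ∃[ w ] Joins e v w
    at⁻ {v = v} e∈ = other-end (∈-select⁻ (incident? v) e∈)

  -- A fourth edge at `v` would contradict the degree: removing `a`, `b`, `c` and `e` in turn lowers
  -- the size of `edges-at v` four times.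
  star-complete : ∀ {v a b c x y z} → Star v a b c x y z → ∀ {e w} → Joins e v w →
                  (e ≡ a × w ≡ x) ⊎ (e ≡ b × w ≡ y) ⊎ (e ≡ c × w ≡ z)
  star-complete {v} {a} {b} {c} s {e} j with e ≟ᶠ a | e ≟ᶠ b | e ≟ᶠ c
  ... | yes refl | _ | _ = inj₁ (refl , joins-end j (a∶x s))
  ... | no _ | yes refl | _ = inj₂ (inj₁ (refl , joins-end j (b∶y s)))
  ... | no _ | no _ | yes refl = inj₂ (inj₂ (refl , joins-end j (c∶z s)))
  ... | no e≢a | no e≢b | no e≢c = contradiction
    (≤-<-trans (≤-<-trans (≤-<-trans (≤-<-trans z≤n
      (x∈p⇒∣p-x∣<∣p∣ e∈)) (x∈p⇒∣p-x∣<∣p∣ c∈)) (x∈p⇒∣p-x∣<∣p∣ b∈)) (x∈p⇒∣p-x∣<∣p∣ (at (a∶x s))))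
    (subst (λ d → ¬ (4 ≤ d)) (sym (cubic v)) λ { (s≤s (s≤s (s≤s ()))) })
    where
    b∈ = x∈p∧x≢y⇒x∈p-y (at (b∶y s)) (a≢b s ∘ sym)
    c∈ = x∈p∧x≢y⇒x∈p-y (x∈p∧x≢y⇒x∈p-y (at (c∶z s)) (a≢c s ∘ sym)) (b≢c s ∘ sym)
    e∈ = x∈p∧x≢y⇒x∈p-y (x∈p∧x≢y⇒x∈p-y (x∈p∧x≢y⇒x∈p-y (at j) e≢a) e≢b) e≢c

  star-from₂ : ∀ {v a b x y} → a ≢ b → Joins a v x → Joins b v y → ∃[ c ] ∃[ z ] Star v a b c x y z
  star-from₂ {v} {a} {b} a≢b ja jb =
    let c , c∈ = nonempty-of-size (suc-injective (suc-injective (trans (sym size) (cubic v))))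
        z , jc = at⁻ (p─q⊆p _ ⁅ a ⁆ (p─q⊆p _ ⁅ b ⁆ c∈))
    in c , z , star a≢b (x∈p-y⇒x≢y (p─q⊆p _ ⁅ b ⁆ c∈) ∘ sym) (x∈p-y⇒x≢y c∈ ∘ sym) ja jb jc
    where
    size : degree v ≡ suc (suc ∣ edges-at v - a - b ∣)
    size = trans (∣p∣≡1+∣p-x∣ (at ja))
                 (cong suc (∣p∣≡1+∣p-x∣ (x∈p∧x≢y⇒x∈p-y (at jb) (a≢b ∘ sym))))

  star-at : ∀ v → ∃[ a ] ∃[ b ] ∃[ c ] ∃[ x ] ∃[ y ] ∃[ z ] Star v a b c x y z
  star-at v =
    let a , a∈ = nonempty-of-size (cubic v)
        b , b∈ = nonempty-of-size (suc-injective (trans (sym (∣p∣≡1+∣p-x∣ a∈)) (cubic v)))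
        x , ja = at⁻ a∈
        y , jb = at⁻ (p─q⊆p _ ⁅ a ⁆ b∈)
        c , z , s = star-from₂ (x∈p-y⇒x≢y b∈ ∘ sym) ja jb
    in a , b , c , x , y , z , s

  rotate : ∀ {v a b c x y z} → Star v a b c x y z → Star v b c a y z x
  rotate (star a≢b a≢c b≢c ja jb jc) = star b≢c (a≢b ∘ sym) (a≢c ∘ sym) jb jc ja

  reflect : ∀ {v a b c x y z} → Star v a b c x y z → Star v c b a z y x
  reflect (star a≢b a≢c b≢c ja jb jc) = star (b≢c ∘ sym) (a≢c ∘ sym) (a≢b ∘ sym) jc jb ja

  -- When the neighbours of `v` contain a path through `y`, its two edges and `b` use up the degree
  -- of `y`, so every neighbour of `y` is among `v`, `x`, `z`. The ends `x` and `z` must differ for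
  -- `p` and `q` to be distinct.
  middle-star : ∀ {v a b c p q x y z} → Star v a b c x y z → x ≢ z → Joins p x y → Joins q y z →
                Star y b p q v x z
  middle-star s x≢z p∶ q∶ = star
    (λ { refl → joins-≢ (a∶x s) (joins-end (joins-sym (b∶y s)) (joins-sym p∶)) })
    (λ { refl → joins-≢ (c∶z s) (joins-end (joins-sym (b∶y s)) q∶) })
    (λ { refl → x≢z (joins-end (joins-sym p∶) q∶) })
    (joins-sym (b∶y s)) (joins-sym p∶) q∶

  -- Triangles and parallel edges.

  Adjacent : Vertex → Vertex → Set
  Adjacent u v = ∃[ e ] Joins e u v

  -- Allowing equality treats a pair of parallel edges as a degenerate triangle, so that both kinds
  -- of cluster share one definition.
  Near : Vertex → Vertex → Set
  Near u v = u ≡ v ⊎ Adjacent u v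

  near? : ∀ u v → Dec (Near u v)
  near? u v = (u ≟ᶠ v) ⊎-dec any? λ e → joins? e u v

  near-sym : ∀ {u v} → Near u v → Near v u
  near-sym (inj₁ p)       = inj₁ (sym p)
  near-sym (inj₂ (e , j)) = inj₂ (e , joins-sym j)

  ClusteredAt : Vertex → Edge → Set
  ClusteredAt v e = ∃[ x ] ∃[ f ] ∃[ y ] Joins e v x × Joins f v y × e ≢ f × Near x y

  -- The edge lies in a triangle or is parallel to another edge.
  Clustered : Edge → Set
  Clustered e = ∃[ v ] ClusteredAt v e

  clustered? : ∀ e → Dec (Clustered e)
  clustered? e = any? λ v → any? λ x → any? λ f → any? λ y →
    joins? e v x ×-dec (joins? f v y ×-dec (¬? (e ≟ᶠ f) ×-dec near? x y))

  -- A cluster can be viewed from either end of `e`: at the opposite end, a triangle shows its third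
  -- edge in place of `f`, and a parallel edge shows itself.
  clustered-at : ∀ {e u v} → Clustered e → Joins e u v →
                 ∃[ f ] ∃[ y ] Joins f u y × e ≢ f × Near y v
  clustered-at (w , x , f , y , e∶x , f∶y , e≢f , near) j with incident-ends j (incidentˡ e∶x)
  ... | inj₁ refl with refl ← joins-end e∶x j = f , y , f∶y , e≢f , near-sym near
  ... | inj₂ refl with refl ← joins-end e∶x (joins-sym j) with near
  ...   | inj₁ refl    = f , _ , joins-sym f∶y , e≢f , inj₁ refl
  ...   | inj₂ (g , k) = g , y , k , (λ { refl → joins-≢ f∶y (joins-end j k) }) ,
                         inj₂ (f , joins-sym f∶y)

  -- Consequences of claw-freeness.

  module _ (clawFree : ClawFree G) where

    -- Otherwise `x`, `y`, `z` are distinct and pairwise non-adjacent, and by `star-complete` no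
    -- further edge joins `v` to them, so the star is an induced claw.
    near-neighbours : ∀ {v a b c x y z} → Star v a b c x y z → Near x y ⊎ Near y z ⊎ Near x z
    near-neighbours {v} {a} {b} {c} {x} {y} {z} s with near? x y | near? y z | near? x z
    ... | yes n | _     | _     = inj₁ n
    ... | no _  | yes n | _     = inj₂ (inj₁ n)
    ... | no _  | no _  | yes n = inj₂ (inj₂ n)
    ... | no ¬xy | no ¬yz | no ¬xz = ⊥-elim (clawFree record
      { onV = leaf ; onE = edge ; onV-injective = leaf-injective _ _ ; onE-injective = edge-injective _ _
      ; preserves = preserves _ ; induced = induced _ _ _ })
      where
      leaf : Fin 4 → Vertex
      leaf zero                   = v
      leaf (suc zero)             = x
      leaf (suc (suc zero))       = y
      leaf (suc (suc (suc zero))) = z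

      edge : Fin 3 → Edge
      edge zero             = a
      edge (suc zero)       = b
      edge (suc (suc zero)) = c

      spoke : ∀ i → Joins (edge i) v (leaf (suc i))
      spoke zero             = a∶x s
      spoke (suc zero)       = b∶y s
      spoke (suc (suc zero)) = c∶z s

      near⇒≡ : ∀ i j → Near (leaf (suc i)) (leaf (suc j)) → i ≡ j
      near⇒≡ zero             zero             _ = refl
      near⇒≡ zero             (suc zero)       n = ⊥-elim (¬xy n)
      near⇒≡ zero             (suc (suc zero)) n = ⊥-elim (¬xz n)
      near⇒≡ (suc zero)       zero             n = ⊥-elim (¬xy (near-sym n))
      near⇒≡ (suc zero)       (suc zero)       _ = refl
      near⇒≡ (suc zero)       (suc (suc zero)) n = ⊥-elim (¬yz n)
      near⇒≡ (suc (suc zero)) zero             n = ⊥-elim (¬xz (near-sym n))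
      near⇒≡ (suc (suc zero)) (suc zero)       n = ⊥-elim (¬yz (near-sym n))
      near⇒≡ (suc (suc zero)) (suc (suc zero)) _ = refl

      leaf-injective : ∀ i j → leaf i ≡ leaf j → i ≡ j
      leaf-injective zero    zero    _ = refl
      leaf-injective zero    (suc j) p = ⊥-elim (joins-≢ (spoke j) p)
      leaf-injective (suc i) zero    p = ⊥-elim (joins-≢ (spoke i) (sym p))
      leaf-injective (suc i) (suc j) p = cong suc (near⇒≡ i j (inj₁ p))

      edge-injective : ∀ i j → edge i ≡ edge j → i ≡ j
      edge-injective i j p =
        near⇒≡ i j (inj₁ (joins-end (subst (λ e → Joins e v _) p (spoke i)) (spoke j)))

      preserves : ∀ e {i j} → Graph.Joins K₁,₃ e i j → Joins (edge e) (leaf i) (leaf j)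
      preserves e (inj₁ refl) = spoke e
      preserves e (inj₂ refl) = joins-sym (spoke e)

      spoke-only : ∀ {f} i → Joins f v (leaf (suc i)) → ∃[ e ] edge e ≡ f
      spoke-only i j with star-complete s j
      ... | inj₁ (refl , _)        = zero , refl
      ... | inj₂ (inj₁ (refl , _)) = suc zero , refl
      ... | inj₂ (inj₂ (refl , _)) = suc (suc zero) , refl

      induced : ∀ f i j → Joins f (leaf i) (leaf j) → ∃[ e ] edge e ≡ f
      induced f zero    zero    k = ⊥-elim (joins-≢ k refl)
      induced f zero    (suc j) k = spoke-only j k
      induced f (suc i) zero    k = spoke-only i (joins-sym k)
      induced f (suc i) (suc j) k with refl ← near⇒≡ i j (inj₂ (f , k)) = ⊥-elim (joins-≢ k refl)

    -- Were the edges to meet at `v`, claw-freeness would give two edges at `v` with near far ends.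
    -- Any two of the three edges at `v` include `e` or `f`, which is then clustered.
    unclustered-matching : ∀ {e f} → ¬ Clustered e → ¬ Clustered f → ¬ Conflict e f
    unclustered-matching ¬e ¬f (e≢f , v , e∋v , f∋v)
      with x , e∶x ← other-end e∋v | y , f∶y ← other-end f∋v
      with c , z , s ← star-from₂ e≢f e∶x f∶y
      with near-neighbours s
    ... | inj₁ n        = ¬e (v , _ , _ , _ , e∶x , f∶y , e≢f , n)
    ... | inj₂ (inj₁ n) = ¬f (v , _ , _ , _ , f∶y , c∶z s , b≢c s , n)
    ... | inj₂ (inj₂ n) = ¬e (v , _ , _ , _ , e∶x , c∶z s , a≢c s , n)

    -- Perfection of a maximal matching that contains all unclustered edges.

    module _ {M : Subset ∣E∣} (M-matching : Matching M)
             (unclustered∈M : ∀ {e} → ¬ Clustered e → e ∈ M)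
             (maximal : ∀ {e} → e ∉ M → ∃[ f ] f ∈ M × Conflict e f) where

      Covered : Vertex → Set
      Covered v = ∃[ e ] ∃[ w ] e ∈ M × Joins e v w

      unmatched-clustered : ∀ {e} → e ∉ M → Clustered e
      unmatched-clustered {e} e∉M = decidable-stable (clustered? e) (e∉M ∘ unclustered∈M)

      matched-unique : ∀ {e f u v w} → e ∈ M → Joins e u v → f ∈ M → Joins f u w → e ≡ f
      matched-unique {e} {f} e∈M e∶v f∈M f∶w with e ≟ᶠ f
      ... | yes e≡f = e≡f
      ... | no e≢f = ⊥-elim (M-matching e∈M f∈M (e≢f , _ , incidentˡ e∶v , incidentˡ f∶w))

      module _ {v} (uncovered : ¬ Covered v) where

        unmatched : ∀ {e w} → Joins e v w → e ∉ M
        unmatched j e∈M = uncovered (_ , _ , e∈M , j)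

        -- By maximality an edge at `v` meets an edge of `M`, and they cannot meet at the uncovered
        -- end `v`.
        neighbour-covered : ∀ {e w} → Joins e v w → Covered w
        neighbour-covered j with f , f∈M , _ , u , e∋u , f∋u ← maximal (unmatched j)
          with incident-ends j e∋u
        ... | inj₁ refl = ⊥-elim (unmatched (proj₂ (other-end f∋u)) f∈M)
        ... | inj₂ refl = _ , _ , f∈M , proj₂ (other-end f∋u)

        -- The third edge m of x is in M and, since c is clustered, ends at y.  The third
        -- edge of y is then clustered too, but v and x have no edge left to enclose it.
        no-parallel : ∀ {a b c x y} → ¬ Star v a b c x x y
        no-parallel {a} {b} {c} {x} {y} s
          with m , u , sx ← star-from₂ (a≢b s) (joins-sym (a∶x s)) (joins-sym (b∶y s))
          = absurd
          where
          m∈M : m ∈ M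
          m∈M with r , w , r∈M , r∶w ← neighbour-covered (a∶x s) with star-complete sx r∶w
          ... | inj₁ (refl , _)        = ⊥-elim (unmatched (a∶x s) r∈M)
          ... | inj₂ (inj₁ (refl , _)) = ⊥-elim (unmatched (b∶y s) r∈M)
          ... | inj₂ (inj₂ (refl , _)) = r∈M

          c≢m : c ≢ m
          c≢m refl = unmatched (c∶z s) m∈M

          -- Otherwise `c` would be a fourth edge at `x`, besides `a`, `b` and `m`.
          y≢x : y ≢ x
          y≢x refl with star-complete sx (joins-sym (c∶z s))
          ... | inj₁ (refl , _)        = a≢c s refl
          ... | inj₂ (inj₁ (refl , _)) = b≢c s refl
          ... | inj₂ (inj₂ (c≡m , _))  = c≢m c≡m

          -- The cluster of `c`, viewed from `v`, runs through `a` or `b`, hence through `x`. As `x`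
          -- and `y` differ, they are adjacent, and the only edge at `x` not leading to `v` is `m`.
          u≡y : u ≡ y
          u≡y with f , w , f∶w , c≢f , near ← clustered-at (unmatched-clustered (unmatched (c∶z s))) (c∶z s)
            = of-neighbour near (of-edge (star-complete s f∶w))
            where
            of-edge : (f ≡ a × w ≡ x) ⊎ (f ≡ b × w ≡ x) ⊎ (f ≡ c × w ≡ y) → w ≡ x
            of-edge (inj₁ (_ , p))        = p
            of-edge (inj₂ (inj₁ (_ , p))) = p
            of-edge (inj₂ (inj₂ (p , _))) = ⊥-elim (c≢f (sym p))

            of-neighbour : Near w y → w ≡ x → u ≡ y
            of-neighbour (inj₁ refl) refl = ⊥-elim (y≢x refl)
            of-neighbour (inj₂ (g , k)) refl with star-complete sx k
            ... | inj₁ (_ , refl)        = ⊥-elim (joins-≢ (c∶z s) refl)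
            ... | inj₂ (inj₁ (_ , refl)) = ⊥-elim (joins-≢ (c∶z s) refl)
            ... | inj₂ (inj₂ (_ , p))    = sym p

          absurd : ⊥
          absurd with refl ← u≡y
            with f , z , sy ← star-from₂ c≢m (joins-sym (c∶z s)) (joins-sym (c∶z sx))
            with g , w , g∶w , f≢g , near ← clustered-at (unmatched-clustered λ f∈M →
                   b≢c sy (matched-unique m∈M (b∶y sy) f∈M (c∶z sy))) (c∶z sy)
            = contra near (star-complete sy g∶w)
            where
            -- All three edges at `v` and all three at `x` stay within `v`, `x`, `y`, and `f` is not
            -- among them. So `z` is a new vertex, near neither `v` nor `x`.
            z≢v : z ≢ v
            z≢v refl with star-complete s (joins-sym (c∶z sy))
            ... | inj₁ (_ , p)           = y≢x p
            ... | inj₂ (inj₁ (_ , p))    = y≢x p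
            ... | inj₂ (inj₂ (refl , _)) = a≢c sy refl

            z≢x : z ≢ x
            z≢x refl with star-complete sx (joins-sym (c∶z sy))
            ... | inj₁ (_ , p)           = joins-≢ (c∶z s) (sym p)
            ... | inj₂ (inj₁ (_ , p))    = joins-≢ (c∶z s) (sym p)
            ... | inj₂ (inj₂ (refl , _)) = b≢c sy refl

            contra : Near w z → (g ≡ c × w ≡ v) ⊎ (g ≡ m × w ≡ x) ⊎ (g ≡ f × w ≡ z) → ⊥
            contra near (inj₂ (inj₂ (p , _))) = f≢g (sym p)
            contra (inj₁ p) (inj₁ (_ , refl)) = z≢v (sym p)
            contra (inj₁ p) (inj₂ (inj₁ (_ , refl))) = z≢x (sym p)
            contra (inj₂ (h , k)) (inj₁ (_ , refl)) with star-complete s k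
            ... | inj₁ (_ , p)           = z≢x p
            ... | inj₂ (inj₁ (_ , p))    = z≢x p
            ... | inj₂ (inj₂ (_ , p))    = joins-≢ (c∶z sy) (sym p)
            contra (inj₂ (h , k)) (inj₂ (inj₁ (_ , refl))) with star-complete sx k
            ... | inj₁ (_ , p)           = z≢v p
            ... | inj₂ (inj₁ (_ , p))    = z≢v p
            ... | inj₂ (inj₂ (_ , p))    = joins-≢ (c∶z sy) (sym p)

        -- If p is in M, the third edge of x is clustered, which forces it to end at z;
        -- now every edge at z meets v or p, so z cannot be covered.
        path-edge-unmatched : ∀ {a b c p q x y z} → Star v a b c x y z → x ≢ y → x ≢ z →
                              Joins p x y → Joins q y z → p ∉ M
        path-edge-unmatched {a} {b} {c} {p} {q} {x} {y} {z} s x≢y x≢z p∶ q∶ p∈M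
          with f , w , sx ← star-from₂ {a = a} {p}
                 (λ { refl → joins-≢ (b∶y s) (joins-end (joins-sym (a∶x s)) p∶) })
                 (joins-sym (a∶x s)) p∶
          with g , u , g∶u , f≢g , near ← clustered-at (unmatched-clustered λ f∈M →
                 b≢c sx (matched-unique p∈M (b∶y sx) f∈M (c∶z sx))) (c∶z sx)
          = z-covered (w≡z near (star-complete sx g∶u)) (neighbour-covered (c∶z s))
          where
          y-star = middle-star s x≢z p∶ q∶

          w≢v : w ≢ v
          w≢v refl with star-complete s (joins-sym (c∶z sx))
          ... | inj₁ (refl , _)     = a≢c sx refl
          ... | inj₂ (inj₁ (_ , e)) = x≢y e
          ... | inj₂ (inj₂ (_ , e)) = x≢z e

          w≢y : w ≢ y
          w≢y refl with star-complete y-star (joins-sym (c∶z sx))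
          ... | inj₁ (_ , refl)        = joins-≢ (a∶x s) refl
          ... | inj₂ (inj₁ (refl , _)) = b≢c sx refl
          ... | inj₂ (inj₂ (_ , e))    = x≢z e

          -- The cluster of `f`, viewed from `x`, runs through `a` or `p`, so `w` is near `v` or `y`
          -- and equal to neither. All neighbours of `v` and of `y` lie among `v`, `x`, `y`, `z`,
          -- which leaves only `z` for `w`.
          w≡z : Near u w → (g ≡ a × u ≡ v) ⊎ (g ≡ p × u ≡ y) ⊎ (g ≡ f × u ≡ w) → w ≡ z
          w≡z _ (inj₂ (inj₂ (e , _))) = ⊥-elim (f≢g (sym e))
          w≡z (inj₁ e) (inj₁ (_ , refl)) = ⊥-elim (w≢v (sym e))
          w≡z (inj₁ e) (inj₂ (inj₁ (_ , refl))) = ⊥-elim (w≢y (sym e))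
          w≡z (inj₂ (h , k)) (inj₁ (_ , refl)) with star-complete s k
          ... | inj₁ (_ , e)        = ⊥-elim (joins-≢ (c∶z sx) (sym e))
          ... | inj₂ (inj₁ (_ , e)) = ⊥-elim (w≢y e)
          ... | inj₂ (inj₂ (_ , e)) = e
          w≡z (inj₂ (h , k)) (inj₂ (inj₁ (_ , refl))) with star-complete y-star k
          ... | inj₁ (_ , e)        = ⊥-elim (w≢v e)
          ... | inj₂ (inj₁ (_ , e)) = ⊥-elim (joins-≢ (c∶z sx) (sym e))
          ... | inj₂ (inj₂ (_ , e)) = e

          z-covered : w ≡ z → Covered z → ⊥
          z-covered refl (r , _ , r∈M , r∶) with star-complete z-star r∶
            where
            -- Of these edges, `c` ends at the uncovered `v`, while `q` and `f` meet the matched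
            -- edge `p` at `y` and at `x`.
            z-star : Star z c q f v y x
            z-star = star (λ { refl → joins-≢ (b∶y s) (joins-end (joins-sym (c∶z s)) (joins-sym q∶)) })
                          (λ { refl → joins-≢ (a∶x s) (joins-end (joins-sym (c∶z s)) (joins-sym (c∶z sx))) })
                          (λ { refl → x≢y (joins-end (joins-sym (c∶z sx)) (joins-sym q∶)) })
                          (joins-sym (c∶z s)) (joins-sym q∶) (joins-sym (c∶z sx))
          ... | inj₁ (refl , _)        = unmatched (c∶z s) r∈M
          ... | inj₂ (inj₁ (refl , _)) = b≢c y-star (matched-unique p∈M (joins-sym p∶) r∈M q∶)
          ... | inj₂ (inj₂ (refl , _)) = b≢c sx (matched-unique p∈M p∶ r∈M (c∶z sx))

        -- The middle vertex `y` is covered, and its edges are `b`, `p`, `q`. The first ends at `v`;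
        -- the other two are excluded by `path-edge-unmatched`, applied from either end of the path.
        no-path : ∀ {a b c p q x y z} → Star v a b c x y z → x ≢ y → x ≢ z → y ≢ z →
                  Joins p x y → ¬ Joins q y z
        no-path s x≢y x≢z y≢z p∶ q∶
          with r , u , r∈M , r∶u ← neighbour-covered (b∶y s)
          with star-complete (middle-star s x≢z p∶ q∶) r∶u
        ... | inj₁ (refl , _)        = unmatched (b∶y s) r∈M
        ... | inj₂ (inj₁ (refl , _)) = path-edge-unmatched s x≢y x≢z p∶ q∶ r∈M
        ... | inj₂ (inj₂ (refl , _)) =
          path-edge-unmatched (reflect s) (y≢z ∘ sym) (x≢z ∘ sym) (joins-sym q∶) (joins-sym p∶) r∈M

        -- The edge `a` ends at the uncovered `v`, so it is unmatched and hence clustered. As `x`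
        -- differs from `y` and `z`, its cluster is a triangle through `b` or `c`.
        adjacent-to-another : ∀ {a b c x y z} → Star v a b c x y z → x ≢ y → x ≢ z →
                              Adjacent x y ⊎ Adjacent x z
        adjacent-to-another s x≢y x≢z
          with f , w , f∶w , a≢f , near ← clustered-at (unmatched-clustered (unmatched (a∶x s))) (a∶x s)
          with star-complete s f∶w | near-sym near
        ... | inj₁ (refl , _)        | _        = contradiction refl a≢f
        ... | inj₂ (inj₁ (_ , refl)) | inj₁ x≡y = contradiction x≡y x≢y
        ... | inj₂ (inj₁ (_ , refl)) | inj₂ xy  = inj₁ xy
        ... | inj₂ (inj₂ (_ , refl)) | inj₁ x≡z = contradiction x≡z x≢z
        ... | inj₂ (inj₂ (_ , refl)) | inj₂ xz  = inj₂ xz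

        -- If the neighbours are distinct, each is adjacent to another one. Two different
        -- adjacencies among three vertices share a vertex and form a path; rotating the star brings
        -- that path into the form that `no-path` excludes.
        no-star : ∀ {a b c x y z} → ¬ Star v a b c x y z
        no-star {x = x} {y} {z} s with x ≟ᶠ y | y ≟ᶠ z | x ≟ᶠ z
        ... | yes refl | _ | _ = no-parallel s
        ... | no _ | yes refl | _ = no-parallel (rotate s)
        ... | no _ | no _ | yes refl = no-parallel (rotate (rotate s))
        ... | no x≢y | no y≢z | no x≢z with adjacent-to-another s x≢y x≢z
        ...   | inj₁ (_ , xy) with adjacent-to-another (rotate (rotate s)) (x≢z ∘ sym) (y≢z ∘ sym)
        ...     | inj₁ (_ , zx) = no-path (rotate (rotate s)) (x≢z ∘ sym) (y≢z ∘ sym) x≢y zx xy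
        ...     | inj₂ (_ , zy) = no-path s x≢y x≢z y≢z xy (joins-sym zy)
        no-star {x = x} {y} {z} s | no x≢y | no y≢z | no x≢z | inj₂ (_ , xz)
          with adjacent-to-another (rotate s) y≢z (x≢y ∘ sym)
        ...   | inj₁ (_ , yz) = no-path (rotate s) y≢z (x≢y ∘ sym) (x≢z ∘ sym) yz (joins-sym xz)
        ...   | inj₂ (_ , yx) =
          no-path (rotate (rotate s)) (x≢z ∘ sym) (y≢z ∘ sym) x≢y (joins-sym xz) (joins-sym yx)

      every-vertex-covered : ∀ v → Covered v
      every-vertex-covered v with covered? v
        where
        covered? : ∀ v → Dec (Covered v)
        covered? v = any? λ e → any? λ w → (e ∈? M) ×-dec joins? e v w
      ... | yes covered = covered
      ... | no uncovered =
        let _ , _ , _ , _ , _ , _ , s = star-at v in ⊥-elim (no-star uncovered s)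

    perfect-matching : ∃[ M ] Matching M × ∀ v → ∃[ e ] e ∈ M × Incident v e
    perfect-matching =
      let M , outer⊆M , M-matching , _ , maximal = maximal-matching full (tabulate (does ∘ unclustered?))
            (λ e∈ f∈ → unclustered-matching (∈-select⁻ unclustered? e∈) (∈-select⁻ unclustered? f∈))
      in M , M-matching , λ v →
        let e , _ , e∈M , j = every-vertex-covered M-matching (outer⊆M ∘ ∈-select unclustered?) (maximal ∈⊤) v
        in e , e∈M , incidentˡ j
      where
      unclustered? : ∀ e → Dec (¬ Clustered e)
      unclustered? e = ¬? (clustered? e)

-- Indicators and finite sums.

indicator : {P : Set} → Dec P → ℕ
indicator P? = if does P? then 1 else 0

indicator-yes : {P : Set} (P? : Dec P) → P → indicator P? ≡ 1
indicator-yes P? p = cong (if_then 1 else 0) (dec-true P? p)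

indicator-no : {P : Set} (P? : Dec P) → ¬ P → indicator P? ≡ 0
indicator-no P? ¬p = cong (if_then 1 else 0) (dec-false P? ¬p)

sum-mono-≤ : ∀ {n} {f g : Fin n → ℕ} → (∀ i → f i ≤ g i) → sum f ≤ sum g
sum-mono-≤ {zero}  f≤g = z≤n
sum-mono-≤ {suc n} f≤g = +-mono-≤ (f≤g zero) (sum-mono-≤ (f≤g ∘ suc))

sum-zero : ∀ {n} {f : Fin n → ℕ} → (∀ i → f i ≡ 0) → sum f ≡ 0
sum-zero {n} f≡0 = trans (sum-cong-≗ f≡0) (sum-replicate-zero n)

sum-unique : ∀ {n} (f : Fin n → ℕ) i → (∀ j → j ≢ i → f j ≡ 0) → sum f ≡ f i
sum-unique f zero    f≡0 = trans (cong (f zero +_) (sum-zero λ j → f≡0 (suc j) λ ())) (+-identityʳ _)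
sum-unique f (suc i) f≡0 = trans (cong (_+ sum (f ∘ suc)) (f≡0 zero λ ()))
  (sum-unique (f ∘ suc) i λ j j≢i → f≡0 (suc j) λ { refl → j≢i refl })

∣p∣≡sum : ∀ {n} (p : Subset n) → ∣ p ∣ ≡ sum (λ i → indicator (i ∈? p))
∣p∣≡sum []            = refl
∣p∣≡sum (inside ∷ p)  = cong suc (∣p∣≡sum p)
∣p∣≡sum (outside ∷ p) = ∣p∣≡sum p

∣select∣≡sum : ∀ {n} {P : Fin n → Set} (P? : ∀ i → Dec (P i)) →
               ∣ tabulate (does ∘ P?) ∣ ≡ sum (indicator ∘ P?)
∣select∣≡sum {zero}  P? = refl
∣select∣≡sum {suc n} P? with does (P? zero)
... | true  = cong suc (∣select∣≡sum (P? ∘ suc))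
... | false = ∣select∣≡sum (P? ∘ suc)

-- Weighted degrees and the handshake identity.

module DegreeSums (G : Graph) where
  open Graph G
  open import Data.Nat using (_*_)

  -- For the indicator of an edge set this is the degree in that set; arbitrary weights make it
  -- additive over disjoint sets.
  degreeIn : (Edge → ℕ) → Vertex → ℕ
  degreeIn g v = sum λ e → indicator (incident? v e) * g e

  degreeIn-+ : ∀ g h v → degreeIn (λ e → g e + h e) v ≡ degreeIn g v + degreeIn h v
  degreeIn-+ g h v = trans
    (sum-cong-≗ λ e → *-distribˡ-+ (indicator (incident? v e)) (g e) (h e))
    (∑-distrib-+ (λ e → indicator (incident? v e) * g e) _)

  degreeIn-1 : ∀ v → degreeIn (λ _ → 1) v ≡ degree v
  degreeIn-1 v = trans (sum-cong-≗ λ e → *-identityʳ (indicator (incident? v e))) (sym (∣select∣≡sum (incident? v)))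

  -- Looplessness prevents both summands from being 1.
  indicator-incident : ∀ v e → indicator (incident? v e) ≡
    indicator (proj₁ (ends e) ≟ᶠ v) + indicator (proj₂ (ends e) ≟ᶠ v)
  indicator-incident v e with proj₁ (ends e) ≟ᶠ v | proj₂ (ends e) ≟ᶠ v
  ... | yes p | yes q = contradiction (trans p (sym q)) (loopless e)
  ... | yes _ | no _  = refl
  ... | no _  | yes _ = refl
  ... | no _  | no _  = refl

  sum-delta : ∀ (h : Vertex → ℕ) u → sum (λ v → h v * indicator (u ≟ᶠ v)) ≡ h u
  sum-delta h u = trans
    (sum-unique _ u λ v v≢u → trans (cong (h v *_) (indicator-no (u ≟ᶠ v) (v≢u ∘ sym)))
                                    (*-zeroʳ (h v)))
    (trans (cong (h u *_) (indicator-yes (u ≟ᶠ u) refl)) (*-identityʳ (h u)))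

  sum-over-ends : ∀ (h : Vertex → ℕ) e →
    sum (λ v → h v * indicator (incident? v e)) ≡ h (proj₁ (ends e)) + h (proj₂ (ends e))
  sum-over-ends h e = begin
    sum (λ v → h v * indicator (incident? v e))
      ≡⟨ sum-cong-≗ (λ v → trans (cong (h v *_) (indicator-incident v e)) (*-distribˡ-+ (h v) _ _)) ⟩
    sum (λ v → h v * indicator (proj₁ (ends e) ≟ᶠ v) + h v * indicator (proj₂ (ends e) ≟ᶠ v))
      ≡⟨ ∑-distrib-+ (λ v → h v * indicator (proj₁ (ends e) ≟ᶠ v)) _ ⟩
    sum (λ v → h v * indicator (proj₁ (ends e) ≟ᶠ v)) + sum (λ v → h v * indicator (proj₂ (ends e) ≟ᶠ v))
      ≡⟨ cong₂ _+_ (sum-delta h _) (sum-delta h _) ⟩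
    h (proj₁ (ends e)) + h (proj₂ (ends e)) ∎
    where open ≡-Reasoning

  -- Double counting: both sides sum `h v * g e` over incident pairs, grouped by vertex on the left
  -- and by edge on the right.
  weighted-handshake : ∀ (h : Vertex → ℕ) (g : Edge → ℕ) →
    sum (λ v → h v * degreeIn g v) ≡ sum (λ e → g e * (h (proj₁ (ends e)) + h (proj₂ (ends e))))
  weighted-handshake h g = begin
    sum (λ v → h v * degreeIn g v)
      ≡⟨ sum-cong-≗ (λ v → *-distribˡ-sum (h v) λ e → indicator (incident? v e) * g e) ⟩
    sum (λ v → sum λ e → h v * (indicator (incident? v e) * g e))
      ≡⟨ ∑-comm (λ v e → h v * (indicator (incident? v e) * g e)) ⟩
    sum (λ e → sum λ v → h v * (indicator (incident? v e) * g e))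
      ≡⟨ sum-cong-≗ (λ e → trans
           (sum-cong-≗ λ v → trans (sym (*-assoc (h v) (indicator (incident? v e)) (g e)))
                                   (*-comm (h v * indicator (incident? v e)) (g e)))
           (sym (*-distribˡ-sum (g e) λ v → h v * indicator (incident? v e)))) ⟩
    sum (λ e → g e * sum λ v → h v * indicator (incident? v e))
      ≡⟨ sum-cong-≗ (λ e → cong (g e *_) (sum-over-ends h e)) ⟩
    sum (λ e → g e * (h (proj₁ (ends e)) + h (proj₂ (ends e)))) ∎
    where open ≡-Reasoning

  handshake : ∀ g → sum (degreeIn g) ≡ 2 * sum g
  handshake g = begin
    sum (degreeIn g)             ≡⟨ sum-cong-≗ (λ v → sym (*-identityˡ (degreeIn g v))) ⟩
    sum (λ v → 1 * degreeIn g v) ≡⟨ weighted-handshake (λ _ → 1) g ⟩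
    sum (λ e → g e * 2)          ≡⟨ sum-cong-≗ (λ e → *-comm (g e) 2) ⟩
    sum (λ e → 2 * g e)          ≡⟨ sym (*-distribˡ-sum 2 g) ⟩
    2 * sum g                    ∎
    where open ≡-Reasoning

-- Size of a perfect matching together with a maximal matching outside it.

module TwoColouring (G : Graph) (cubic : Cubic G) where
  open Graph G
  open Matchings G
  open DegreeSums G
  open import Data.Nat using (_*_)

  sum-const : ∀ n k → sum {n} (λ _ → k) ≡ n * k
  sum-const zero    k = refl
  sum-const (suc n) k = cong (k +_) (sum-const n k)

  member : Subset ∣E∣ → Edge → ℕ
  member S e = indicator (e ∈? S)

  -- Any other edge of `M` at `v` would conflict with `e`.
  covered-degree : ∀ {M e v} → Matching M → e ∈ M → Incident v e → degreeIn (member M) v ≡ 1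
  covered-degree {M} {e} {v} M-matching e∈M e∋v = trans
    (sum-unique _ e λ f f≢e → others f f≢e)
    (cong₂ _*_ (indicator-yes (incident? v e) e∋v) (indicator-yes (e ∈? M) e∈M))
    where
    others : ∀ f → f ≢ e → indicator (incident? v f) * member M f ≡ 0
    others f f≢e with incident? v f
    ... | no f∌v  = cong (_* member M f) (indicator-no (incident? v f) f∌v)
    ... | yes f∋v = trans
      (cong (indicator (incident? v f) *_) (indicator-no (f ∈? M) λ f∈M → M-matching f∈M e∈M (f≢e , v , f∋v , e∋v)))
      (*-zeroʳ (indicator (incident? v f)))

  uncovered-degree : ∀ {M v} → (∀ e → e ∈ M → ¬ Incident v e) → degreeIn (member M) v ≡ 0
  uncovered-degree {M} {v} uncovered = sum-zero λ e → zero-at e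
    where
    zero-at : ∀ e → indicator (incident? v e) * member M e ≡ 0
    zero-at e with incident? v e
    ... | no e∌v  = cong (_* member M e) (indicator-no (incident? v e) e∌v)
    ... | yes e∋v = trans
      (cong (indicator (incident? v e) *_) (indicator-no (e ∈? M) λ e∈M → uncovered e e∈M e∋v))
      (*-zeroʳ (indicator (incident? v e)))

  covered? : ∀ M v → Dec (∃[ e ] e ∈ M × Incident v e)
  covered? M v = any? λ e → (e ∈? M) ×-dec incident? v e

  module _ {M N : Subset ∣E∣} (M-matching : Matching M) (N-matching : Matching N)
           (perfect : ∀ v → ∃[ e ] e ∈ M × Incident v e)
           (disjoint : ∀ {e} → e ∈ N → e ∉ M)
           (N-maximal : ∀ {e} → e ∉ M → e ∉ N → ∃[ f ] f ∈ N × Conflict e f) where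

    private
      m x l : Edge → ℕ
      m = member M
      x = member N
      l = member (∁ (M ∪ N))

    member-∪ : ∀ e → member (M ∪ N) e ≡ m e + x e
    member-∪ e with e ∈? M | e ∈? N
    ... | yes e∈M | yes e∈N = contradiction e∈M (disjoint e∈N)
    ... | yes e∈M | no _    = indicator-yes (e ∈? (M ∪ N)) (x∈p∪q⁺ (inj₁ e∈M))
    ... | no _    | yes e∈N = indicator-yes (e ∈? (M ∪ N)) (x∈p∪q⁺ (inj₂ e∈N))
    ... | no e∉M  | no e∉N  = indicator-no (e ∈? (M ∪ N)) ([ e∉M , e∉N ]′ ∘ x∈p∪q⁻ M N)

    member-∁ : ∀ S e → member S e + member (∁ S) e ≡ 1
    member-∁ S e with e ∈? S
    ... | yes e∈S = cong suc (indicator-no (e ∈? ∁ S) (x∈p⇒x∉∁p e∈S))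
    ... | no e∉S  = indicator-yes (e ∈? ∁ S) (x∉p⇒x∈∁p e∉S)

    edge-partition : ∀ e → m e + x e + l e ≡ 1
    edge-partition e = trans (cong (_+ l e) (sym (member-∪ e))) (member-∁ (M ∪ N) e)

    degree-partition : ∀ v → degreeIn m v + degreeIn x v + degreeIn l v ≡ 3
    degree-partition v = begin
      degreeIn m v + degreeIn x v + degreeIn l v       ≡⟨ cong (_+ degreeIn l v) (sym (degreeIn-+ m x v)) ⟩
      degreeIn (λ e → m e + x e) v + degreeIn l v      ≡⟨ sym (degreeIn-+ (λ e → m e + x e) l v) ⟩
      degreeIn (λ e → m e + x e + l e) v               ≡⟨ sum-cong-≗ (λ e →
                                                             cong (indicator (incident? v e) *_) (edge-partition e)) ⟩
      degreeIn (λ _ → 1) v                             ≡⟨ degreeIn-1 v ⟩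
      degree v                                         ≡⟨ cubic v ⟩
      3                                                ∎
      where open ≡-Reasoning

    m-degree : ∀ v → degreeIn m v ≡ 1
    m-degree v with e , e∈M , e∋v ← perfect v = covered-degree M-matching e∈M e∋v

    -- A vertex covered by N lies on only one edge outside M ∪ N.
    leftover-degree : ∀ v → degreeIn x v * degreeIn l v ≤ degreeIn x v
    leftover-degree v with covered? N v
    ... | no uncovered = ≤-reflexive (trans (cong (_* degreeIn l v) x≡0) (sym x≡0))
      where
      x≡0 : degreeIn x v ≡ 0
      x≡0 = uncovered-degree λ e e∈N e∋v → uncovered (e , e∈N , e∋v)
    ... | yes (e , e∈N , e∋v) = ≤-reflexive (trans (cong (degreeIn x v *_) l≡1) (*-identityʳ _))
      where
      l≡1 : degreeIn l v ≡ 1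
      -- Of the three edges at `v`, one is in `M` and one in `N`.
      l≡1 = suc-injective (suc-injective (trans
        (cong (_+ degreeIn l v) (sym (cong₂ _+_ (m-degree v) (covered-degree N-matching e∈N e∋v))))
        (degree-partition v)))

    -- By maximality of `N`, a leftover edge meets an edge of `N`, and the shared end has degree 1
    -- in `N`.
    leftover-has-covered-end : ∀ e → l e ≤ l e * (degreeIn x (proj₁ (ends e)) + degreeIn x (proj₂ (ends e)))
    leftover-has-covered-end e with e ∈? ∁ (M ∪ N)
    ... | no _ = z≤n
    ... | yes e∈
      with f , f∈N , _ , v , e∋v , f∋v ← N-maximal (x∈∁p⇒x∉p e∈ ∘ p⊆p∪q N) (x∈∁p⇒x∉p e∈ ∘ q⊆p∪q M N)
      with d ← covered-degree N-matching f∈N f∋v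
      with e∋v
    -- The outer `m≤m+n` accounts for `1 * s`, which computes to `s + 0`.
    ... | inj₁ refl = ≤-trans (≤-trans (≤-reflexive (sym d)) (m≤m+n _ _)) (m≤m+n _ _)
    ... | inj₂ refl = ≤-trans (≤-trans (≤-reflexive (sym d)) (m≤n+m _ (degreeIn x (proj₁ (ends e))))) (m≤m+n _ _)

    -- Counts the pairs of a leftover edge and an end of it covered by `N`, with `degreeIn x` as the
    -- indicator of being covered. Each leftover edge is in at least one pair, and each covered
    -- vertex in at most one.
    leftover≤ : sum l ≤ 2 * sum x
    leftover≤ = begin
      sum l                                       ≤⟨ sum-mono-≤ leftover-has-covered-end ⟩
      sum (λ e → l e * (degreeIn x (proj₁ (ends e)) + degreeIn x (proj₂ (ends e))))
                                                  ≡⟨ sym (weighted-handshake (degreeIn x) l) ⟩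
      sum (λ v → degreeIn x v * degreeIn l v)     ≤⟨ sum-mono-≤ leftover-degree ⟩
      sum (degreeIn x)                            ≡⟨ handshake x ⟩
      2 * sum x                                   ∎
      where open ≤-Reasoning

    order≡2m : ∣V∣ ≡ 2 * sum m
    order≡2m = begin
      ∣V∣                ≡⟨ sym (*-identityʳ ∣V∣) ⟩
      ∣V∣ * 1            ≡⟨ sym (sum-const ∣V∣ 1) ⟩
      sum {∣V∣} (λ _ → 1) ≡⟨ sum-cong-≗ (λ v → sym (m-degree v)) ⟩
      sum (degreeIn m)   ≡⟨ handshake m ⟩
      2 * sum m          ∎
      where open ≡-Reasoning

    -- Every vertex has two edges outside `M`, so by the handshake identity the edges outside `M`
    -- are as many as the vertices.
    2m≡x+l : 2 * sum m ≡ sum x + sum l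
    2m≡x+l = *-cancelˡ-≡ _ _ 2 (begin
      2 * (2 * sum m)                       ≡⟨ cong (2 *_) (sym order≡2m) ⟩
      2 * ∣V∣                               ≡⟨ *-comm 2 ∣V∣ ⟩
      ∣V∣ * 2                               ≡⟨ sym (sum-const ∣V∣ 2) ⟩
      sum {∣V∣} (λ _ → 2)                   ≡⟨ sum-cong-≗ (λ v → sym (x+l-degree v)) ⟩
      sum (degreeIn (λ e → x e + l e))      ≡⟨ handshake (λ e → x e + l e) ⟩
      2 * sum (λ e → x e + l e)             ≡⟨ cong (2 *_) (∑-distrib-+ x l) ⟩
      2 * (sum x + sum l)                   ∎)
      where
      open ≡-Reasoning
      x+l-degree : ∀ v → degreeIn (λ e → x e + l e) v ≡ 2
      x+l-degree v = trans (degreeIn-+ x l v) (suc-injective (trans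
        (cong (λ d → d + degreeIn x v + degreeIn l v) (sym (m-degree v))) (degree-partition v)))

    size-bound : 5 * ∣V∣ ≤ 6 * ∣ M ∪ N ∣
    size-bound = begin
      5 * ∣V∣                          ≡⟨ cong (5 *_) order≡2m ⟩
      -- Splitting 10 as 6 + 4 leaves `6 * sum m` for the goal and turns the rest into twice the
      -- number of edges outside `M`, which is at most `6 * sum x`.
      5 * (2 * sum m)                  ≡⟨ solve 1 (λ a →
        con 5 :* (con 2 :* a) := con 6 :* a :+ con 2 :* (con 2 :* a)) refl (sum m) ⟩
      6 * sum m + 2 * (2 * sum m)      ≡⟨ cong (λ k → 6 * sum m + 2 * k) 2m≡x+l ⟩
      6 * sum m + 2 * (sum x + sum l)  ≤⟨ +-monoʳ-≤ (6 * sum m) (*-monoʳ-≤ 2 (+-monoʳ-≤ (sum x) leftover≤)) ⟩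
      6 * sum m + 2 * (sum x + 2 * sum x) ≡⟨ solve 2 (λ a b →
        con 6 :* a :+ con 2 :* (b :+ con 2 :* b) := con 6 :* (a :+ b)) refl (sum m) (sum x) ⟩
      6 * (sum m + sum x)              ≡⟨ cong (6 *_) (sym (∑-distrib-+ m x)) ⟩
      6 * sum (λ e → m e + x e)        ≡⟨ cong (6 *_) (sum-cong-≗ (λ e → sym (member-∪ e))) ⟩
      6 * sum (member (M ∪ N))         ≡⟨ cong (6 *_) (sym (∣p∣≡sum (M ∪ N))) ⟩
      6 * ∣ M ∪ N ∣                    ∎
      where
      open ≤-Reasoning
      open +-*-Solver

    union-colourable : ColourableSize 2 G ∣ M ∪ N ∣
    union-colourable =
      record { vertices = full ; edges = M ∪ N ; closed = λ _ _ → ∈⊤ } ,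
      (colour , λ e f e∈ f∈ e≢f share → proper e f (x∈p∪q⁻ M N e∈) (x∈p∪q⁻ M N f∈) (e≢f , share)) ,
      refl
      where
      -- Edges in neither matching also receive the second colour; `ProperOn` does not constrain
      -- them.
      colour : Edge → Fin 2
      colour e = if does (e ∈? M) then zero else suc zero

      proper : ∀ e f → e ∈ M ⊎ e ∈ N → f ∈ M ⊎ f ∈ N → Conflict e f → colour e ≢ colour f
      proper e f e∈ f∈ e#f with e ∈? M | f ∈? M
      ... | yes e∈M | yes f∈M = contradiction e#f (M-matching e∈M f∈M)
      ... | yes _   | no _    = λ ()
      ... | no _    | yes _   = λ ()
      ... | no e∉M  | no f∉M  =
        contradiction e#f (N-matching ([ (λ e∈M → contradiction e∈M e∉M) , id ]′ e∈)
                                      ([ (λ f∈M → contradiction f∈M f∉M) , id ]′ f∈))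

  two-colouring-bound : ∀ {M} → Matching M → (∀ v → ∃[ e ] e ∈ M × Incident v e) → 5 * ∣V∣ ≤ 6 * ν 2 G
  two-colouring-bound {M} M-matching perfect
    -- Starting from the empty matching and admitting only edges of `∁ M` makes `N` disjoint from
    -- `M` and maximal outside it.
    with N , _ , N-matching , N⊆∁M , maximal ← maximal-matching (∁ M) ∅ (λ e∈∅ → ⊥-elim (∉⊥ e∈∅))
    = ≤-trans (size-bound M-matching N-matching perfect disjoint N-maximal)
        (*-monoʳ-≤ 6 (proj₂ (ν-isMaximum 2 G) _
          (union-colourable M-matching N-matching perfect disjoint N-maximal)))
    where
    disjoint : ∀ {e} → e ∈ N → e ∉ M
    disjoint e∈N = [ (λ e∈∅ → ⊥-elim (∉⊥ e∈∅)) , x∈∁p⇒x∉p ]′ (N⊆∁M e∈N)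

    N-maximal : ∀ {e} → e ∉ M → e ∉ N → ∃[ f ] f ∈ N × Conflict e f
    N-maximal e∉M = maximal (x∉p⇒x∈∁p e∉M)

-- The bound as an inequality of rationals.

open import Data.Integer using (+_)
open import Data.Rational using (_/_; _*_; _≥_)

-- The second argument of `mkℚᵘ` is the denominator minus one, so the fractions are 5/6, n/1 and
-- k/1, and the order on them is the cross-multiplied integer inequality.
≤⇒≤ᵘ : ∀ {n k} → 5 Nat.* n ≤ 6 Nat.* k → mkℚᵘ (+ 5) 5 ℚᵘ.* mkℚᵘ (+ n) 0 ℚᵘ.≤ mkℚᵘ (+ k) 0
≤⇒≤ᵘ {n} {k} 5n≤6k = ℚᵘ.*≤* (subst₂ ℤ._≤_
  (trans (ℤ.pos-* 5 n) (sym (ℤ.*-identityʳ (+ 5 ℤ.* + n))))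
  (trans (ℤ.pos-* 6 k) (ℤ.*-comm (+ 6) (+ k)))
  (ℤ.+≤+ 5n≤6k))

theorem8 : (G : Graph) → Cubic G → ClawFree G →
    + ν 2 G / 1 ≥ (+ 5 / 6) * (+ Graph.∣V∣ G / 1)
theorem8 G cubic clawFree = toℚᵘ-cancel-≤
  (ℚᵘ.≤-respˡ-≃ (ℚᵘ.≃-sym product) (ℚᵘ.≤-respʳ-≃ (ℚᵘ.≃-sym (toℚᵘ-fromℚᵘ (mkℚᵘ (+ ν 2 G) 0)))
    (≤⇒≤ᵘ {n} {ν 2 G} 5n≤6ν)))
  where
  n = Graph.∣V∣ G

  5n≤6ν : 5 Nat.* n ≤ 6 Nat.* ν 2 G
  5n≤6ν =
    let _ , M-matching , perfect = CubicGraph.perfect-matching G cubic clawFree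
    in TwoColouring.two-colouring-bound G cubic M-matching perfect

  -- Multiplication in ℚ reduces fractions, which is stuck on a variable `n`. Up to `≃` the
  -- unnormalised product has the explicit denominators that `≤⇒≤ᵘ` expects.
  product : toℚᵘ ((+ 5 / 6) * (+ n / 1)) ℚᵘ.≃ mkℚᵘ (+ 5) 5 ℚᵘ.* mkℚᵘ (+ n) 0
  product = ℚᵘ.≃-trans (toℚᵘ-homo-* (+ 5 / 6) (+ n / 1))
    (ℚᵘ.*-cong (toℚᵘ-fromℚᵘ (mkℚᵘ (+ 5) 5)) (toℚᵘ-fromℚᵘ (mkℚᵘ (+ n) 0)))
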